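{- Let $k \geq 1$ and $N\ge 1$ be integers and let $n=(8k+4)N+1$. There is a set of mutually orthogonal cyclic $(4k+2)$-cycle systems of order $n$ of size at least \[ \frac{N}{96k+30}-1=\frac{n-1}{(8k+4)(96k+30)}-1. \] Thus, if $n\equiv 1\pmod{2(4k+2)}$, then $\mu(4k+2,n)\geq \mu'(4k+2,n)\geq \frac{n-1}{(8k+4)(96k+30)}-1$.
   Context: An $\ell$-cycle system of order $n$ is a set of $\ell$-cycles whose edge sets partition the edge set of $K_n$. Two such systems $\mathcal F,\mathcal F'$ are orthogonal if every $C\in\mathcal F$ and $C'\in\mathcal F'$ share at most one edge; mutually orthogonal means pairwise orthogonal. With vertex set $\mathbb{Z}_n$, a system is cyclic if it is closed under translating every cycle by any $g\in\mathbb{Z}_n$. $\mu(\ell,n)$ (resp. $\mu'(\ell,n)$) is the maximum size of a set of mutually orthogonal (resp. mutually orthogonal cyclic) $\ell$-cycle systems of order $n$. -}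

module Defs where

open import Data.Nat using (ℕ; zero; suc; _+_; _*_; _≤_)
open import Data.Nat.DivMod using (_%_; m%n<n)
open import Data.Fin using (Fin; toℕ; fromℕ<)
open import Data.Product using (Σ; _×_; _,_)
open import Data.Sum using (_⊎_)
open import Relation.Binary.PropositionalEquality using (_≡_; _≢_)
open import Function.Definitions using (Injective)
open import Function.Bundles using (_⇔_)

-- Vertex set of K_n is ℤ_n, represented as Fin (suc m) with n = suc m.
-- Addition modulo n (used for translations).
_⊕_ : ∀ {m} → Fin (suc m) → Fin (suc m) → Fin (suc m)
_⊕_ {m} x g = fromℕ< (m%n<n (toℕ x + toℕ g) (suc m))

csuc : ∀ {p} → Fin (suc p) → Fin (suc p)
csuc {p} i = fromℕ< (m%n<n (suc (toℕ i)) (suc p))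

WalkEdge : ∀ {p m} → (Fin (suc p) → Fin (suc m)) → Fin (suc m) → Fin (suc m) → Set
WalkEdge {p} v x y = Σ (Fin (suc p)) λ i →
  ((v i ≡ x) × (v (csuc i) ≡ y)) ⊎ ((v i ≡ y) × (v (csuc i) ≡ x))

-- An ℓ-cycle (ℓ = suc p) in K_n (n = suc m): a cyclic sequence of ℓ
-- distinct vertices v 0, v 1, ..., v (ℓ-1); its edges are {v i, v (i+1 mod ℓ)}.
record Cycle (p m : ℕ) : Set where
  field
    vtx : Fin (suc p) → Fin (suc m)
    distinct : Injective _≡_ _≡_ vtx
open Cycle public

HasEdge : ∀ {p m} → Cycle p m → Fin (suc m) → Fin (suc m) → Set
HasEdge C x y = WalkEdge (vtx C) x y

-- An ℓ-cycle system of order n: a finite family of ℓ-cycles such that every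
-- edge {x,y} (x ≠ y) of K_n lies in exactly one cycle of the family.
-- (Cycles are determined by their edge sets; a repeated cycle would violate
-- uniqueness, so the family is a set of cycles whose edge sets partition E(K_n).)
record CycleSystem (p m : ℕ) : Set where
  field
    size   : ℕ
    cycle  : Fin size → Cycle p m
    partition : ∀ x y → x ≢ y →
      Σ (Fin size) λ i → HasEdge (cycle i) x y ×
        (∀ j → HasEdge (cycle j) x y → j ≡ i)
open CycleSystem public

-- cyclic: closed under translation by every g ∈ ℤ_n
-- (the translate C + g has vertex sequence v i + g; it must coincide,
--  as a cycle i.e. as an edge set, with some cycle of the system)
IsCyclic : ∀ {p m} → CycleSystem p m → Set
IsCyclic {p} {m} F = ∀ (i : Fin (size F)) (g : Fin (suc m)) →
  Σ (Fin (size F)) λ j → ∀ x y →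
    HasEdge (cycle F j) x y ⇔ WalkEdge (λ t → vtx (cycle F i) t ⊕ g) x y

Orthogonal : ∀ {p m} → CycleSystem p m → CycleSystem p m → Set
Orthogonal {p} {m} F F' = ∀ (i : Fin (size F)) (j : Fin (size F')) →
  ∀ (x y u w : Fin (suc m)) →
    HasEdge (cycle F i) x y → HasEdge (cycle F' j) x y →
    HasEdge (cycle F i) u w → HasEdge (cycle F' j) u w →
    ((x ≡ u) × (y ≡ w)) ⊎ ((x ≡ w) × (y ≡ u))

MOCCS : (p m r : ℕ) → Set
MOCCS p m r = Σ (Fin r → CycleSystem p m) λ F →
  (∀ a → IsCyclic (F a)) × (∀ a b → a ≢ b → Orthogonal (F a) (F b))

module Submission where

-- Put ℓ = 4k + 2 and n = 2ℓN + 1, and split the differences 1, …, ℓN into columns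
-- cN + 1, …, cN + N.  In system α (0 ≤ α < r), base block i takes one difference from every
-- column: with y = (i + αx) mod N it is cN + 1 + y or, at a reversed position, cN + N - y,
-- where x is the label of the position.  The block jumps up from 0 by a difference of column
-- 2k + 2 and one of column 4k + 1, then runs through the remaining columns in increasing order
-- with alternating signs -, +.  This zigzag expands in both directions, so its vertices are
-- distinct.  Every label is used twice, with signs and reversals such that the y's cancel, and
-- the walk has total length exactly n, so it closes up modulo n.
--
-- If blocks of the systems α ≠ β share two edges, these occupy the same two positions in both.
-- When their labels differ, (α - β)(x - x′) ≡ 0 modulo N, which is impossible for small α, β.
-- When their labels agree, the common displacement between the two edges forces an agreement
-- of the remaining differences between them, and two of the labels involved are different.

open import Defs
open import Data.Nat
  using (ℕ; zero; suc; _+_; _*_; _∸_; _≤_; _<_; z≤n; s≤s; z<s; s<s; _≤?_; _≟_;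
    compare; less; equal; greater)
open import Data.Nat.Properties
open import Data.Nat.DivMod
open import Data.Nat.Tactic.RingSolver using (solve-∀)
open import Data.Fin using (Fin; toℕ; fromℕ<; remQuot; combine)
open import Data.Fin.Properties
  using (toℕ-fromℕ<; toℕ<n; toℕ-injective; remQuot-combine; combine-remQuot)
open import Data.Product using (Σ; _×_; _,_; proj₁; proj₂; uncurry)
open import Data.Sum using (_⊎_; inj₁; inj₂; [_,_]; swap) renaming (map to map⊎)
open import Data.Bool using (Bool; true; false; not)
open import Data.Empty using (⊥; ⊥-elim)
open import Function using (_∘_; case_of_)
open import Function.Bundles using (mk⇔)
open import Relation.Nullary using (yes; no)
open import Relation.Binary.Definitions using (tri<; tri≈; tri>)
open import Relation.Binary.PropositionalEquality
  using (_≡_; _≢_; refl; sym; trans; cong; cong₂; subst; subst₂; module ≡-Reasoning)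

-- Congruence of natural numbers modulo `suc m`.

module Residue (m : ℕ) where

  infix 4 _≈_
  record _≈_ (a b : ℕ) : Set where
    constructor mk≈
    field rem-≡ : a % suc m ≡ b % suc m
  open _≈_ public

  ≈-refl : ∀ {a} → a ≈ a
  ≈-refl = mk≈ refl

  ≈-reflexive : ∀ {a b} → a ≡ b → a ≈ b
  ≈-reflexive refl = ≈-refl

  ≈-sym : ∀ {a b} → a ≈ b → b ≈ a
  ≈-sym (mk≈ e) = mk≈ (sym e)

  ≈-trans : ∀ {a b c} → a ≈ b → b ≈ c → a ≈ c
  ≈-trans (mk≈ e) (mk≈ f) = mk≈ (trans e f)

  +-cong≈ : ∀ {a b c d} → a ≈ b → c ≈ d → a + c ≈ b + d
  +-cong≈ {a} {b} {c} {d} (mk≈ e) (mk≈ f) = mk≈ (begin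
    (a + c) % suc m                     ≡⟨ %-distribˡ-+ a c (suc m) ⟩
    (a % suc m + c % suc m) % suc m     ≡⟨ cong₂ (λ u v → (u + v) % suc m) e f ⟩
    (b % suc m + d % suc m) % suc m     ≡⟨ sym (%-distribˡ-+ b d (suc m)) ⟩
    (b + d) % suc m ∎)
    where open ≡-Reasoning

  +-congˡ≈ : ∀ c {a b} → a ≈ b → c + a ≈ c + b
  +-congˡ≈ c = +-cong≈ {c} ≈-refl

  +-congʳ≈ : ∀ c {a b} → a ≈ b → a + c ≈ b + c
  +-congʳ≈ c h = +-cong≈ h (≈-refl {c})

  +-multiple≈ : ∀ a q → a + q * suc m ≈ a
  +-multiple≈ a q = mk≈ ([m+kn]%n≡m%n a q (suc m))

  +-modulus≈ : ∀ a → a + suc m ≈ a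
  +-modulus≈ a = mk≈ ([m+n]%n≡m%n a (suc m))

  -- `c * m` serves as the negative of `c`, because `c + c * m` is a multiple of the modulus.
  +-cancelʳ≈ : ∀ c {a b} → a + c ≈ b + c → a ≈ b
  +-cancelʳ≈ c {a} {b} h =
    ≈-trans (≈-sym (inv a)) (≈-trans (+-cong≈ h ≈-refl) (inv b))
    where
    inv : ∀ a → a + c + c * m ≈ a
    inv a = ≈-trans (≈-reflexive (identity a c m)) (+-multiple≈ a c)
      where
      identity : ∀ a c m → a + c + c * m ≡ a + c * suc m
      identity = solve-∀

  +-cancelˡ≈ : ∀ c {a b} → c + a ≈ c + b → a ≈ b
  +-cancelˡ≈ c {a} {b} h =
    +-cancelʳ≈ c (subst₂ _≈_ (+-comm c a) (+-comm c b) h)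

  %≈ : ∀ a → a % suc m ≈ a
  %≈ a = mk≈ (m%n%n≡m%n a (suc m))

  ≈⇒≡ : ∀ {a b} → a < suc m → b < suc m → a ≈ b → a ≡ b
  ≈⇒≡ a< b< (mk≈ e) = trans (sym (m<n⇒m%n≡m a<)) (trans e (m<n⇒m%n≡m b<))

  difference≈ : ∀ x y → Σ ℕ λ e → (e < suc m) × (y ≈ x + e)
  difference≈ x y = (y + x * m) % suc m , m%n<n (y + x * m) (suc m) ,
    ≈-sym (≈-trans (+-cong≈ (≈-refl {x}) (%≈ (y + x * m)))
      (≈-trans (≈-reflexive (identity x y m)) (+-multiple≈ y x)))
    where
    identity : ∀ x y m → x + (y + x * m) ≡ y + x * suc m
    identity = solve-∀

  -- The two congruences say that `q - p` and `q′ - p′` are congruent, and these displacements are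
  -- `e - f` and `e′ - f′`.
  offsets-cancel : ∀ p p′ q q′ e e′ f f′ {g g′} →
    p + g ≈ p′ + g′ → q + g ≈ q′ + g′ →
    p + e ≡ q + f → p′ + e′ ≡ q′ + f′ → e + f′ ≈ e′ + f
  offsets-cancel p p′ q q′ e e′ f f′ {g} {g′} hp hq he hf =
    +-cancelʳ≈ (p + g + (q′ + g′))
      (≈-trans (≈-reflexive rearranged) (+-congˡ≈ (e′ + f) (≈-sym (+-cong≈ hp (≈-sym hq)))))
    where
    open ≡-Reasoning
    id₁ : ∀ p g q′ g′ e f′ → e + f′ + (p + g + (q′ + g′)) ≡ (p + e) + (q′ + f′) + (g + g′)
    id₁ = solve-∀
    id₂ : ∀ q f p′ e′ g g′ → (q + f) + (p′ + e′) + (g + g′) ≡ e′ + f + (p′ + g′ + (q + g))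
    id₂ = solve-∀
    rearranged : e + f′ + (p + g + (q′ + g′)) ≡ e′ + f + (p′ + g′ + (q + g))
    rearranged = begin
      e + f′ + (p + g + (q′ + g′))       ≡⟨ id₁ p g q′ g′ e f′ ⟩
      (p + e) + (q′ + f′) + (g + g′)     ≡⟨ cong₂ (λ u v → u + v + (g + g′)) he (sym hf) ⟩
      (q + f) + (p′ + e′) + (g + g′)     ≡⟨ id₂ q f p′ e′ g g′ ⟩
      e′ + f + (p′ + g′ + (q + g)) ∎

  residue : ℕ → Fin (suc m)
  residue a = fromℕ< (m%n<n a (suc m))

  toℕ-residue : ∀ a → toℕ (residue a) ≡ a % suc m
  toℕ-residue a = toℕ-fromℕ< (m%n<n a (suc m))

  toℕ-residue≈ : ∀ a → toℕ (residue a) ≈ a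
  toℕ-residue≈ a = ≈-trans (≈-reflexive (toℕ-residue a)) (%≈ a)

  residue-cong : ∀ {a b} → a ≈ b → residue a ≡ residue b
  residue-cong {a} {b} (mk≈ e) =
    toℕ-injective (trans (toℕ-residue a) (trans e (sym (toℕ-residue b))))

  toℕ-≈-injective : ∀ {x y : Fin (suc m)} → toℕ x ≈ toℕ y → x ≡ y
  toℕ-≈-injective {x} {y} h = toℕ-injective (≈⇒≡ (toℕ<n x) (toℕ<n y) h)

  ≈⇒residue≡ : ∀ {a} {x : Fin (suc m)} → toℕ x ≈ a → residue a ≡ x
  ≈⇒residue≡ {a} h = toℕ-≈-injective (≈-trans (toℕ-residue≈ a) (≈-sym h))

  residue≡⇒≈ : ∀ {a} {x : Fin (suc m)} → residue a ≡ x → toℕ x ≈ a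
  residue≡⇒≈ {a} refl = toℕ-residue≈ a

-- Cyclic cycle systems developed from base blocks.

-- A cyclic difference family modulo `suc (L + L)`: each of 1, ..., `L` is the length of exactly one
-- edge. Recording an edge by its lower end and its length orients it independently of the direction
-- of travel.
record Starter (p N L : ℕ) : Set where
  open Residue (L + L)
  field
    vertex low diff : Fin N → ℕ → ℕ
    step : ∀ i {t} → t ≤ p →
      (vertex i t ≡ low i t × vertex i (suc t) ≡ low i t + diff i t) ⊎
      (vertex i (suc t) ≡ low i t × vertex i t ≡ low i t + diff i t)
    vertex-close : ∀ i → vertex i (suc p) ≈ vertex i 0
    vertex-injective : ∀ i {s t} → s ≤ p → t ≤ p → vertex i s ≈ vertex i t → s ≡ t
    diff-positive : ∀ i t → 1 ≤ diff i t
    diff-bounded : ∀ i {t} → t ≤ p → diff i t ≤ L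
    diff-injective : ∀ {i j s t} → s ≤ p → t ≤ p → diff i s ≡ diff j t → i ≡ j × s ≡ t
    diff-surjective : ∀ {e} → 1 ≤ e → e ≤ L →
      Σ (Fin N) λ i → Σ ℕ λ t → t ≤ p × diff i t ≡ e

module _ {p N L : ℕ} where

  open Residue (L + L)

  private
    n = suc (L + L)

  diff-<n : ∀ {a} → a ≤ L → a < n
  diff-<n a≤L = s≤s (≤-trans a≤L (m≤m+n L L))

  Arc : ℕ → ℕ → Fin n → Fin n → Set
  Arc l d x y = toℕ x ≈ l × toℕ y ≈ l + d

  arc-diff : ∀ {l l′ d d′ x y} → d ≤ L → d′ ≤ L → Arc l d x y → Arc l′ d′ x y → d ≡ d′
  arc-diff {l} {l′} {d} {d′} d≤ d′≤ (xl , yl) (xl′ , yl′) =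
    ≈⇒≡ (diff-<n d≤) (diff-<n d′≤) (+-cancelˡ≈ l
      (≈-trans (≈-sym yl) (≈-trans yl′
        (+-cong≈ (≈-trans (≈-sym xl′) xl) ≈-refl))))

  -- Otherwise `d + d′` would be congruent to 0, although it lies between 1 and `L + L`.
  arc-asymmetric : ∀ {l l′ d d′ x y} → 1 ≤ d → d ≤ L → d′ ≤ L →
    Arc l d x y → Arc l′ d′ y x → ⊥
  arc-asymmetric {l} {l′} {d} {d′} 1≤d d≤ d′≤ (xl , yl) (yl′ , xl′) =
    n≮n 0 (≤-trans 1≤d (≤-trans (m≤m+n d d′) (≤-reflexive (≈⇒≡ (s≤s (+-mono-≤ d≤ d′≤)) z<s
      (+-cancelˡ≈ l (≈-trans (≈-reflexive (sym (+-assoc l d d′)))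
        (≈-trans (+-cong≈ (≈-trans (≈-sym yl) yl′) ≈-refl)
          (≈-trans (≈-sym xl′) (≈-trans xl (≈-reflexive (sym (+-identityʳ l))))))))))))

  arc-shift : ∀ l d g {a b} → residue (l + g) ≡ a → residue (l + d + g) ≡ b → Arc (l + g) d a b
  arc-shift l d g ha hb = residue≡⇒≈ ha ,
    ≈-trans (residue≡⇒≈ hb) (≈-reflexive (identity l d g))
    where
    identity : ∀ l d g → l + d + g ≡ l + g + d
    identity = solve-∀

  arc-unshift : ∀ l d g {a b} → Arc (l + g) d a b → (residue (l + g) ≡ a) × (residue (l + d + g) ≡ b)
  arc-unshift l d g (al , bl) = ≈⇒residue≡ al ,
    ≈⇒residue≡ (≈-trans bl (≈-reflexive (identity l d g)))
    where
    identity : ∀ l d g → l + g + d ≡ l + d + g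
    identity = solve-∀

  module Development (S : Starter p N L) where
    open Starter S

    block : Fin N → Fin n → Cycle p (L + L)
    block i g = record
      { vtx = λ t → residue (vertex i (toℕ t) + toℕ g)
      ; distinct = λ {s} {t} e → toℕ-injective
          (vertex-injective i (index≤ s) (index≤ t)
            (+-cancelʳ≈ (toℕ g) (≈-trans (≈-sym (toℕ-residue≈ _))
              (≈-trans (≈-reflexive (cong toℕ e)) (toℕ-residue≈ _)))))
      }
      where
      index≤ : ∀ (t : Fin (suc p)) → toℕ t ≤ p
      index≤ t = <⇒≤pred (toℕ<n t)

    vertex-csuc : ∀ i (t : Fin (suc p)) → vertex i (toℕ (csuc t)) ≈ vertex i (suc (toℕ t))
    vertex-csuc i t with m≤n⇒m<n∨m≡n (<⇒≤pred (toℕ<n t))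
    ... | inj₁ t<p = ≈-reflexive (cong (vertex i)
            (trans (toℕ-fromℕ< (m%n<n (suc (toℕ t)) (suc p))) (m<n⇒m%n≡m (s<s t<p))))
    -- At the last index `csuc` wraps around to 0, and `vertex-close` identifies that vertex with
    -- the one at `suc p`.
    ... | inj₂ t≡p = ≈-trans (≈-reflexive (cong (vertex i)
            (trans (toℕ-fromℕ< (m%n<n (suc (toℕ t)) (suc p)))
              (trans (cong (λ u → suc u % suc p) t≡p) (n%n≡0 (suc p))))))
            (≈-trans (≈-sym (vertex-close i)) (≈-reflexive (cong (vertex i ∘ suc) (sym t≡p))))

    block-csuc : ∀ i g t → vtx (block i g) (csuc t) ≡ residue (vertex i (suc (toℕ t)) + toℕ g)
    block-csuc i g t = residue-cong (+-cong≈ (vertex-csuc i t) ≈-refl)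

    BlockArc : Fin N → Fin n → ℕ → Fin n → Fin n → Set
    BlockArc i g t x y = Arc (low i t + toℕ g) (diff i t) x y

    edge⇒arc : ∀ {i g x y} → HasEdge (block i g) x y →
      Σ ℕ λ t → t ≤ p × (BlockArc i g t x y ⊎ BlockArc i g t y x)
    edge⇒arc {i} {g} {x} {y} (t , ends) = toℕ t , t≤p , orient (step i t≤p) ends
      where
      t≤p = <⇒≤pred (toℕ<n t)
      shifted = arc-shift (low i (toℕ t)) (diff i (toℕ t)) (toℕ g)
      here : ∀ {v a} → vertex i (toℕ t) ≡ v → vtx (block i g) t ≡ a → residue (v + toℕ g) ≡ a
      here refl e = e
      next : ∀ {v a} → vertex i (suc (toℕ t)) ≡ v → vtx (block i g) (csuc t) ≡ a → residue (v + toℕ g) ≡ a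
      next refl e = trans (sym (block-csuc i g t)) e
      orient : _ → _ → BlockArc i g (toℕ t) x y ⊎ BlockArc i g (toℕ t) y x
      orient (inj₁ (l , h)) (inj₁ (a , b)) = inj₁ (shifted (here l a) (next h b))
      orient (inj₁ (l , h)) (inj₂ (b , a)) = inj₂ (shifted (here l b) (next h a))
      orient (inj₂ (l , h)) (inj₁ (a , b)) = inj₂ (shifted (next l b) (here h a))
      orient (inj₂ (l , h)) (inj₂ (b , a)) = inj₁ (shifted (next l a) (here h b))

    arc⇒edge : ∀ {i g t x y} → t ≤ p → BlockArc i g t x y → HasEdge (block i g) x y
    arc⇒edge {i} {g} {t} {x} {y} t≤p arc = s , orient (step i t≤p) (arc-unshift (low i t) (diff i t) (toℕ g) arc)
      where
      s : Fin (suc p)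
      s = fromℕ< (s≤s t≤p)
      s≡t : toℕ s ≡ t
      s≡t = toℕ-fromℕ< (s≤s t≤p)
      here : ∀ {v} → vertex i t ≡ v → vtx (block i g) s ≡ residue (v + toℕ g)
      here e = cong (λ v → residue (v + toℕ g)) (trans (cong (vertex i) s≡t) e)
      next : ∀ {v} → vertex i (suc t) ≡ v → vtx (block i g) (csuc s) ≡ residue (v + toℕ g)
      next e = trans (block-csuc i g s)
        (cong (λ v → residue (v + toℕ g)) (trans (cong (vertex i ∘ suc) s≡t) e))
      orient : _ → _ →
        (vtx (block i g) s ≡ x × vtx (block i g) (csuc s) ≡ y) ⊎
        (vtx (block i g) s ≡ y × vtx (block i g) (csuc s) ≡ x)
      orient (inj₁ (l , h)) (a , b) = inj₁ (trans (here l) a , trans (next h) b)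
      orient (inj₂ (l , h)) (a , b) = inj₂ (trans (here h) b , trans (next l) a)

    edge-sym : ∀ {C : Cycle p (L + L)} {x y} → HasEdge C x y → HasEdge C y x
    edge-sym (t , e) = t , swap e

    -- The length of the arc determines the base block and the position; its lower end then
    -- determines the translation.
    arc-unique : ∀ {i j g h s t x y} → s ≤ p → t ≤ p →
      BlockArc i g s x y → BlockArc j h t x y → i ≡ j × g ≡ h
    arc-unique s≤ t≤ a b with diff-injective s≤ t≤ (arc-diff (diff-bounded _ s≤) (diff-bounded _ t≤) a b)
    ... | refl , refl = refl ,
      toℕ-≈-injective (+-cancelˡ≈ _ (≈-trans (≈-sym (proj₁ a)) (proj₁ b)))

    edge-unique : ∀ {i j g h t x y} → t ≤ p → BlockArc i g t x y →
      HasEdge (block j h) x y → j ≡ i × h ≡ g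
    edge-unique t≤ a e with edge⇒arc e
    ... | s , s≤ , inj₁ b = arc-unique s≤ t≤ b a
    ... | s , s≤ , inj₂ b =
      ⊥-elim (arc-asymmetric (diff-positive _ _) (diff-bounded _ t≤) (diff-bounded _ s≤) a b)

    arc-exists : ∀ {e} x y → 1 ≤ e → e ≤ L → toℕ y ≈ toℕ x + e →
      Σ (Fin N) λ i → Σ (Fin n) λ g → Σ ℕ λ t → t ≤ p × BlockArc i g t x y
    arc-exists {e} x y 1≤e e≤L y≈ with diff-surjective 1≤e e≤L
    ... | i , t , t≤p , refl = i , g , t , t≤p , x≈ , ≈-trans y≈ (+-cong≈ x≈ ≈-refl)
      where
      -- The factor `L + L` acts as -1, so this translation carries `low i t` to `x`.
      g = residue (toℕ x + low i t * (L + L))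
      identity : ∀ x l m → l + (x + l * m) ≡ x + l * suc m
      identity = solve-∀
      x≈ : toℕ x ≈ low i t + toℕ g
      x≈ = ≈-sym (≈-trans (+-congˡ≈ (low i t) (toℕ-residue≈ _))
        (≈-trans (≈-reflexive (identity (toℕ x) (low i t) (L + L))) (+-multiple≈ _ (low i t))))

    arc-or-reverse : ∀ x y → x ≢ y →
      Σ (Fin N) λ i → Σ (Fin n) λ g → Σ ℕ λ t → t ≤ p × (BlockArc i g t x y ⊎ BlockArc i g t y x)
    arc-or-reverse x y x≢y with difference≈ (toℕ x) (toℕ y)
    ... | zero , _ , y≈ =
      ⊥-elim (x≢y (toℕ-≈-injective (≈-sym (≈-trans y≈ (≈-reflexive (+-identityʳ _))))))
    ... | suc e , e<n , y≈ with suc e ≤? L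
    ...   | yes e≤L = let i , g , t , t≤p , a = arc-exists x y (s≤s z≤n) e≤L y≈
                      in i , g , t , t≤p , inj₁ a
    -- A difference above `L` is replaced by its complement `c` in the modulus, which leads from `y`
    -- back to `x`.
    ...   | no e≰L with m≤n⇒∃[o]m+o≡n (<⇒≤ e<n)
    ...     | c , e+c≡n =
      let i , g , t , t≤p , a = arc-exists y x 1≤c c≤L x≈ in i , g , t , t≤p , inj₂ a
      where
      x≈ : toℕ x ≈ toℕ y + c
      x≈ = ≈-sym (≈-trans (+-cong≈ y≈ ≈-refl)
        (≈-trans (≈-reflexive (trans (+-assoc (toℕ x) (suc e) c) (cong (toℕ x +_) e+c≡n)))
          (+-modulus≈ (toℕ x))))
      1≤c : 1 ≤ c
      1≤c = +-cancelˡ-< (suc e) 0 c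
        (subst₂ _<_ (sym (+-identityʳ (suc e))) (sym e+c≡n) e<n)
      c≤L : c ≤ L
      c≤L = +-cancelˡ-≤ (suc L) c L
        (≤-trans (+-monoˡ-≤ c (≰⇒> e≰L)) (≤-reflexive e+c≡n))

    blockOf : Fin (N * n) → Cycle p (L + L)
    blockOf = uncurry block ∘ remQuot n

    blockOf-combine : ∀ i g → blockOf (combine i g) ≡ block i g
    blockOf-combine i g = cong (uncurry block) (remQuot-combine i g)

    edge-combine : ∀ {i g x y} → HasEdge (block i g) x y → HasEdge (blockOf (combine i g)) x y
    edge-combine {i} {g} {x} {y} =
      subst (λ C → HasEdge C x y) (sym (blockOf-combine i g))

    system : CycleSystem p (L + L)
    system = record { size = N * n ; cycle = blockOf ; partition = λ x y → part x y ∘ arc-or-reverse x y }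
      where
      index-≡ : ∀ {i g} j → proj₁ (remQuot {N} n j) ≡ i × proj₂ (remQuot {N} n j) ≡ g → j ≡ combine i g
      index-≡ j (refl , refl) = sym (combine-remQuot {N} n j)
      part : ∀ x y → _ → _
      part x y (i , g , t , t≤p , inj₁ a) = combine i g , edge-combine (arc⇒edge t≤p a) ,
        λ j e → index-≡ j (edge-unique t≤p a e)
      part x y (i , g , t , t≤p , inj₂ a) = combine i g ,
        edge-combine (edge-sym {block i g} (arc⇒edge t≤p a)) ,
        λ j e → index-≡ j (edge-unique t≤p a (edge-sym {blockOf j} e))

    system-cyclic : IsCyclic system
    system-cyclic c h = combine i (g ⊕ h) , λ x y → mk⇔
      (λ e → along same (subst (λ C → HasEdge C x y) (blockOf-combine i (g ⊕ h)) e))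
      (λ e → edge-combine {i} {g ⊕ h} (along (sym ∘ same) e))
      where
      i = proj₁ (remQuot {N} n c)
      g = proj₂ (remQuot {N} n c)
      along : ∀ {v w : Fin (suc p) → Fin n} → (∀ t → v t ≡ w t) →
        ∀ {x y} → WalkEdge v x y → WalkEdge w x y
      along {v} {w} v≡w (t , ends) = t , map⊎ both both ends
        where
        both : ∀ {a b} → v t ≡ a × v (csuc t) ≡ b → w t ≡ a × w (csuc t) ≡ b
        both (e , f) = trans (sym (v≡w t)) e , trans (sym (v≡w (csuc t))) f
      same : ∀ t → vtx (block i (g ⊕ h)) t ≡ vtx (block i g) t ⊕ h
      same t = residue-cong (≈-trans (+-congˡ≈ (vertex i (toℕ t)) (toℕ-residue≈ (toℕ g + toℕ h)))
        (≈-trans (≈-reflexive (sym (+-assoc (vertex i (toℕ t)) (toℕ g) (toℕ h))))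
          (+-congʳ≈ (toℕ h) (≈-sym (toℕ-residue≈ (vertex i (toℕ t) + toℕ g))))))

  module _ (S S′ : Starter p N L) where
    private
      module S = Starter S
      module S′ = Starter S′
      module D = Development S
      module D′ = Development S′

    -- A common edge has the same length in both blocks, so `aligned` puts it at the same position
    -- in both. By `rigid` two common edges have the same position, and a position of a block
    -- carries only one edge.
    orthogonal :
      (∀ {i i′ s s′} → s ≤ p → s′ ≤ p → S.diff i s ≡ S′.diff i′ s′ → s ≡ s′) →
      (∀ i i′ g g′ {s t} → s ≤ p → t ≤ p →
        S.diff i s ≡ S′.diff i′ s → S.diff i t ≡ S′.diff i′ t →
        S.low i s + g ≈ S′.low i′ s + g′ → S.low i t + g ≈ S′.low i′ t + g′ → s ≡ t) →
      Orthogonal D.system D′.system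
    orthogonal aligned rigid c c′ x y u w xy xy′ uw uw′ = meet (share xy xy′) (share uw uw′)
      where
      i = proj₁ (remQuot {N} n c)
      g = proj₂ (remQuot {N} n c)
      i′ = proj₁ (remQuot {N} n c′)
      g′ = proj₂ (remQuot {N} n c′)
      Shared : ℕ → Fin n → Fin n → Set
      Shared t x y = S.diff i t ≡ S′.diff i′ t × S.low i t + toℕ g ≈ S′.low i′ t + toℕ g′ ×
        (D.BlockArc i g t x y ⊎ D.BlockArc i g t y x)
      same-way : ∀ {s s′ x y} → s ≤ p → s′ ≤ p → D.BlockArc i g s x y → D′.BlockArc i′ g′ s′ x y →
        S.diff i s ≡ S′.diff i′ s × S.low i s + toℕ g ≈ S′.low i′ s + toℕ g′
      same-way {s} {s′} s≤ s′≤ a a′ with arc-diff (S.diff-bounded i s≤) (S′.diff-bounded i′ s′≤) a a′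
      ... | d≡ with aligned s≤ s′≤ d≡
      ...   | refl = d≡ , ≈-trans (≈-sym (proj₁ a)) (proj₁ a′)
      share : ∀ {x y} → HasEdge (D.block i g) x y → HasEdge (D′.block i′ g′) x y →
        Σ ℕ λ t → t ≤ p × Shared t x y
      share e e′ with D.edge⇒arc e | D′.edge⇒arc e′
      ... | s , s≤ , inj₁ a | s′ , s′≤ , inj₁ a′ =
        let d , l = same-way s≤ s′≤ a a′ in s , s≤ , d , l , inj₁ a
      ... | s , s≤ , inj₂ a | s′ , s′≤ , inj₂ a′ =
        let d , l = same-way s≤ s′≤ a a′ in s , s≤ , d , l , inj₂ a
      ... | s , s≤ , inj₁ a | s′ , s′≤ , inj₂ a′ = ⊥-elim
        (arc-asymmetric (S.diff-positive i s) (S.diff-bounded i s≤) (S′.diff-bounded i′ s′≤) a a′)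
      ... | s , s≤ , inj₂ a | s′ , s′≤ , inj₁ a′ = ⊥-elim
        (arc-asymmetric (S.diff-positive i s) (S.diff-bounded i s≤) (S′.diff-bounded i′ s′≤) a a′)
      arc-ends : ∀ {l d} {x y u w : Fin n} → Arc l d x y → Arc l d u w → x ≡ u × y ≡ w
      arc-ends (a , b) (c , d) =
        toℕ-≈-injective (≈-trans a (≈-sym c)) , toℕ-≈-injective (≈-trans b (≈-sym d))
      meet : Σ ℕ (λ s → s ≤ p × Shared s x y) → Σ ℕ (λ t → t ≤ p × Shared t u w) →
        (x ≡ u × y ≡ w) ⊎ (x ≡ w × y ≡ u)
      meet (s , s≤ , ds , ls , a) (t , t≤ , dt , lt , b)
        with rigid i i′ (toℕ g) (toℕ g′) s≤ t≤ ds dt ls lt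
      meet (s , s≤ , ds , ls , inj₁ a) (t , t≤ , dt , lt , inj₁ b) | refl = inj₁ (arc-ends a b)
      meet (s , s≤ , ds , ls , inj₂ a) (t , t≤ , dt , lt , inj₂ b) | refl =
        inj₁ (let e , f = arc-ends a b in f , e)
      meet (s , s≤ , ds , ls , inj₁ a) (t , t≤ , dt , lt , inj₂ b) | refl = inj₂ (arc-ends a b)
      meet (s , s≤ , ds , ls , inj₂ a) (t , t≤ , dt , lt , inj₁ b) | refl =
        inj₂ (let e , f = arc-ends a b in f , e)

-- Doubling, interleaving, skipping and order.

double : ℕ → ℕ
double zero = zero
double (suc n) = suc (suc (double n))

double≡+ : ∀ n → double n ≡ n + n
double≡+ zero = refl
double≡+ (suc n) = cong suc (trans (cong suc (double≡+ n)) (sym (+-suc n n)))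

double-≤⁻ : ∀ {a b} → double a ≤ suc (double b) → a ≤ b
double-≤⁻ {zero} _ = z≤n
double-≤⁻ {suc a} {suc b} (s≤s (s≤s h)) = s≤s (double-≤⁻ h)
double-≤⁻ {suc a} {zero} (s≤s ())

double-mono-≤ : ∀ {a b} → a ≤ b → double a ≤ double b
double-mono-≤ z≤n = z≤n
double-mono-≤ (s≤s h) = s≤s (s≤s (double-mono-≤ h))

n≤double : ∀ n → n ≤ double n
n≤double n = ≤-trans (m≤m+n n n) (≤-reflexive (sym (double≡+ n)))

data Parity : ℕ → Set where
  even : ∀ j → Parity (double j)
  odd  : ∀ j → Parity (suc (double j))

parity : ∀ t → Parity t
parity zero = even zero
parity (suc t) with parity t
... | even j = odd j
... | odd j = even (suc j)

alternate : {A : Set} → (ℕ → A) → (ℕ → A) → ℕ → A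
alternate f g zero = f zero
alternate f g (suc zero) = g zero
alternate f g (suc (suc t)) = alternate (f ∘ suc) (g ∘ suc) t

alternate-even : ∀ {A : Set} (f g : ℕ → A) j → alternate f g (double j) ≡ f j
alternate-even f g zero = refl
alternate-even f g (suc j) = alternate-even (f ∘ suc) (g ∘ suc) j

alternate-odd : ∀ {A : Set} (f g : ℕ → A) j → alternate f g (suc (double j)) ≡ g j
alternate-odd f g zero = refl
alternate-odd f g (suc j) = alternate-odd (f ∘ suc) (g ∘ suc) j

-- The increasing enumeration of the naturals with the first argument left out.
skip : ℕ → ℕ → ℕ
skip zero u = suc u
skip (suc c) zero = zero
skip (suc c) (suc u) = suc (skip c u)

skip-≤ : ∀ c u → skip c u ≤ suc u
skip-≤ zero u = ≤-refl
skip-≤ (suc c) zero = z≤n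
skip-≤ (suc c) (suc u) = s≤s (skip-≤ c u)

skip-≢ : ∀ c u → skip c u ≢ c
skip-≢ zero u ()
skip-≢ (suc c) zero ()
skip-≢ (suc c) (suc u) e = skip-≢ c u (suc-injective e)

skip-< : ∀ c u → skip c u < skip c (suc u)
skip-< zero u = ≤-refl
skip-< (suc c) zero = z<s
skip-< (suc c) (suc u) = s<s (skip-< c u)

skip-injective : ∀ c {u v} → skip c u ≡ skip c v → u ≡ v
skip-injective zero e = suc-injective e
skip-injective (suc c) {zero} {zero} e = refl
skip-injective (suc c) {suc u} {suc v} e = cong suc (skip-injective c (suc-injective e))

skip-surjective : ∀ c {a b} → a ≤ b → c ≤ b → a ≢ c → Σ ℕ λ u → u < b × skip c u ≡ a
skip-surjective zero {zero} _ _ a≢c = ⊥-elim (a≢c refl)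
skip-surjective zero {suc a} a≤b _ _ = a , a≤b , refl
skip-surjective (suc c) {zero} _ c≤b _ = 0 , ≤-trans z<s c≤b , refl
skip-surjective (suc c) {suc a} (s≤s a≤b) (s≤s c≤b) a≢c =
  let u , u<b , e = skip-surjective c a≤b c≤b (a≢c ∘ cong suc) in suc u , s<s u<b , cong suc e

-- The omitted number is even, so the two entries lie both below it or both above it.
skip-consecutive : ∀ c p → skip (double c) (suc (double p)) ≡ suc (skip (double c) (double p))
skip-consecutive zero p = refl
skip-consecutive (suc c) zero = refl
skip-consecutive (suc c) (suc p) = cong (suc ∘ suc) (skip-consecutive c p)

<-step⇒mono : ∀ (f : ℕ → ℕ) → (∀ j → f j < f (suc j)) → ∀ {a b} → a < b → f a < f b
<-step⇒mono f f< {a} {suc b} a<1+b with m<1+n⇒m<n∨m≡n a<1+b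
... | inj₁ a<b = <-trans (<-step⇒mono f f< a<b) (f< b)
... | inj₂ refl = f< b

mono⇒injective : ∀ (f : ℕ → ℕ) → (∀ {a b} → a < b → f a < f b) → ∀ {a b} → f a ≡ f b → a ≡ b
mono⇒injective f mono {a} {b} e with <-cmp a b
... | tri< a<b _ _ = ⊥-elim (<-irrefl e (mono a<b))
... | tri≈ _ a≡b _ = a≡b
... | tri> _ _ b<a = ⊥-elim (<-irrefl (sym e) (mono b<a))

+-balance-< : ∀ {a b x y} → a + x ≡ b + y → x < y → b < a
+-balance-< {a} {b} e x<y with a ≤? b
... | yes a≤b = ⊥-elim (<-irrefl e (+-mono-≤-< a≤b x<y))
... | no a≰b = ≰⇒> a≰b

-- The equation is `(a - b) * (x - y) = 0`; `compare` keeps the first factor nonnegative.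
crossed-products : ∀ a b x y → a * x + b * y ≡ b * x + a * y → a ≡ b ⊎ x ≡ y
crossed-products a b x y e with compare a b
... | equal _ = inj₁ refl
... | less a c = inj₂ (sym (*-cancelˡ-≡ y x (suc c) (+-cancelˡ-≡ (a * x + a * y) _ _
        (trans (id₁ a c x y) (trans e (id₂ a c x y))))))
  where
  id₁ : ∀ a c x y → a * x + a * y + suc c * y ≡ a * x + suc (a + c) * y
  id₁ = solve-∀
  id₂ : ∀ a c x y → suc (a + c) * x + a * y ≡ a * x + a * y + suc c * x
  id₂ = solve-∀
... | greater b c = inj₂ (*-cancelˡ-≡ x y (suc c) (+-cancelˡ-≡ (b * x + b * y) _ _
        (trans (id₁ b c x y) (trans e (id₂ b c x y)))))
  where
  id₁ : ∀ b c x y → b * x + b * y + suc c * x ≡ suc (b + c) * x + b * y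
  id₁ = solve-∀
  id₂ : ∀ b c x y → b * x + suc (b + c) * y ≡ b * x + b * y + suc c * y
  id₂ = solve-∀

-- Labels and reversals of the positions.

-- Positions 0 and 1 are the two initial jumps; 2 + 2p and 3 + 2p are the p-th descent and
-- ascent of the zigzag.
quadLabel : ℕ → ℕ
quadLabel 0 = 0
quadLabel 1 = 1
quadLabel 2 = 0
quadLabel 3 = 1
quadLabel (suc (suc (suc (suc u)))) = suc (suc (quadLabel u))

quadReversed : ℕ → Bool
quadReversed 0 = true
quadReversed 1 = true
quadReversed 2 = false
quadReversed 3 = false
quadReversed (suc (suc (suc (suc u)))) = quadReversed u

label : ℕ → ℕ
label 0 = 0
label 1 = 2
label 2 = 1
label 3 = 0
label 4 = 1
label 5 = 2
label (suc (suc (suc (suc (suc (suc u)))))) = 3 + quadLabel u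

reversed : ℕ → Bool
reversed 0 = true
reversed 1 = true
reversed 2 = true
reversed 3 = false
reversed 4 = false
reversed 5 = false
reversed (suc (suc (suc (suc (suc (suc u)))))) = quadReversed u

quadLabel-≤ : ∀ u → quadLabel u ≤ u
quadLabel-≤ 0 = z≤n
quadLabel-≤ 1 = ≤-refl
quadLabel-≤ 2 = z≤n
quadLabel-≤ 3 = s≤s z≤n
quadLabel-≤ (suc (suc (suc (suc u)))) = s≤s (s≤s (m≤n⇒m≤o+n 2 (quadLabel-≤ u)))

label-≤ : ∀ t → label t ≤ suc t
label-≤ 0 = z≤n
label-≤ 1 = ≤-refl
label-≤ 2 = s≤s z≤n
label-≤ 3 = z≤n
label-≤ 4 = s≤s z≤n
label-≤ 5 = s≤s (s≤s z≤n)
label-≤ (suc (suc (suc (suc (suc (suc u)))))) = s≤s (s≤s (s≤s (m≤n⇒m≤o+n 4 (quadLabel-≤ u))))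

isOdd : ℕ → Bool
isOdd zero = false
isOdd (suc zero) = true
isOdd (suc (suc n)) = isOdd n

isOdd-suc : ∀ n → isOdd (suc n) ≡ not (isOdd n)
isOdd-suc zero = refl
isOdd-suc (suc zero) = refl
isOdd-suc (suc (suc n)) = isOdd-suc n

quadLabel-even : ∀ q → isOdd (quadLabel (double q)) ≡ false
quadLabel-even 0 = refl
quadLabel-even 1 = refl
quadLabel-even (suc (suc q)) = quadLabel-even q

quadLabel-odd : ∀ q → isOdd (quadLabel (suc (double q))) ≡ true
quadLabel-odd 0 = refl
quadLabel-odd 1 = refl
quadLabel-odd (suc (suc q)) = quadLabel-odd q

label-odd : ∀ q → isOdd (label (double (suc q))) ≡ true
label-odd 0 = refl
label-odd 1 = refl
label-odd (suc (suc q)) = trans (isOdd-suc (quadLabel (double q))) (cong not (quadLabel-even q))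

label-even : ∀ q → isOdd (label (suc (double (suc q)))) ≡ false
label-even 0 = refl
label-even 1 = refl
label-even (suc (suc q)) = trans (isOdd-suc (quadLabel (suc (double q)))) (cong not (quadLabel-odd q))

-- Descents have odd labels and ascents even ones. This contradicts the extra agreement forced
-- between two descents or two ascents with one label.
label-parity-≢ : ∀ q r → label (double (suc q)) ≢ label (suc (double (suc r)))
label-parity-≢ q r e = case trans (sym (label-odd q)) (trans (cong isOdd e) (label-even r)) of λ ()

-- Covers all pairs of positions with one label, by the shape of the path between them: the jumps 0
-- and 1 go with the ascents 3 and 5, and otherwise two successive descents or two successive
-- ascents are paired.
data Twin : ℕ → ℕ → Set where
  twin₀ : Twin 0 3
  twin₁ : Twin 1 5
  twin₂ : ∀ u → Twin (2 + u) (4 + u)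

-- `quadLabel` takes each value at two positions, two apart; this is the earlier one.
quadFirst : ℕ → ℕ
quadFirst 0 = 0
quadFirst 1 = 1
quadFirst (suc (suc x)) = 4 + quadFirst x

quad-position : ∀ u → u ≡ quadFirst (quadLabel u) ⊎ u ≡ 2 + quadFirst (quadLabel u)
quad-position 0 = inj₁ refl
quad-position 1 = inj₁ refl
quad-position 2 = inj₂ refl
quad-position 3 = inj₂ refl
quad-position (suc (suc (suc (suc u)))) = map⊎ (cong (4 +_)) (cong (4 +_)) (quad-position u)

firstAt secondAt : ℕ → ℕ
firstAt 0 = 0
firstAt 1 = 2
firstAt 2 = 1
firstAt (suc (suc (suc x))) = 6 + quadFirst x
secondAt 0 = 3
secondAt 1 = 4
secondAt 2 = 5
secondAt (suc (suc (suc x))) = 8 + quadFirst x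

position : ∀ t → t ≡ firstAt (label t) ⊎ t ≡ secondAt (label t)
position 0 = inj₁ refl
position 1 = inj₁ refl
position 2 = inj₁ refl
position 3 = inj₂ refl
position 4 = inj₂ refl
position 5 = inj₂ refl
position (suc (suc (suc (suc (suc (suc u)))))) = map⊎ (cong (6 +_)) (cong (6 +_)) (quad-position u)

twins : ∀ x → Twin (firstAt x) (secondAt x)
twins 0 = twin₀
twins 1 = twin₂ 0
twins 2 = twin₁
twins (suc (suc (suc x))) = twin₂ (4 + quadFirst x)

label-fibre : ∀ s t → label s ≡ label t → s ≡ t ⊎ Twin s t ⊎ Twin t s
label-fibre s t e with position s | position t
... | inj₁ p | inj₁ q = inj₁ (trans p (trans (cong firstAt e) (sym q)))
... | inj₂ p | inj₂ q = inj₁ (trans p (trans (cong secondAt e) (sym q)))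
... | inj₁ p | inj₂ q = inj₂ (inj₁
  (subst₂ Twin (sym p) (sym (trans q (cong secondAt (sym e)))) (twins (label s))))
... | inj₂ p | inj₁ q = inj₂ (inj₂
  (subst₂ Twin (sym (trans q (cong firstAt (sym e)))) (sym p) (twins (label s))))

-- This and the next three facts make the digits of paired descents, and of paired ascents,
-- complementary in `high-quad`.
quad-label₀ : ∀ q → quadLabel (double (double q)) ≡ quadLabel (2 + double (double q))
quad-label₀ zero = refl
quad-label₀ (suc q) = cong (2 +_) (quad-label₀ q)

quad-label₁ : ∀ q → quadLabel (1 + double (double q)) ≡ quadLabel (3 + double (double q))
quad-label₁ zero = refl
quad-label₁ (suc q) = cong (2 +_) (quad-label₁ q)

quad-reversed₀ : ∀ q → quadReversed (double (double q)) ≡ not (quadReversed (2 + double (double q)))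
quad-reversed₀ zero = refl
quad-reversed₀ (suc q) = quad-reversed₀ q

quad-reversed₁ : ∀ q → quadReversed (1 + double (double q)) ≡ not (quadReversed (3 + double (double q)))
quad-reversed₁ zero = refl
quad-reversed₁ (suc q) = quad-reversed₁ q

-- Reflections and columns.

module Reflection (N′ : ℕ) where

  reflect : Bool → ℕ → ℕ
  reflect false y = y
  reflect true y = N′ ∸ y

  reflect-≤ : ∀ b {y} → y ≤ N′ → reflect b y ≤ N′
  reflect-≤ false y≤ = y≤
  reflect-≤ true {y} y≤ = m∸n≤m N′ y

  reflect-involutive : ∀ b {y} → y ≤ N′ → reflect b (reflect b y) ≡ y
  reflect-involutive false y≤ = refl
  reflect-involutive true y≤ = m∸[m∸n]≡n y≤

  reflect-injective : ∀ b {y y′} → y ≤ N′ → y′ ≤ N′ → reflect b y ≡ reflect b y′ → y ≡ y′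
  reflect-injective b y≤ y′≤ e =
    trans (sym (reflect-involutive b y≤)) (trans (cong (reflect b) e) (reflect-involutive b y′≤))

  reflect-+-not : ∀ b {y} → y ≤ N′ → reflect (not b) y + reflect b y ≡ N′
  reflect-+-not false y≤ = m∸n+n≡m y≤
  reflect-+-not true y≤ = m+[n∸m]≡n y≤

module Columns (k′ : ℕ) where

  k last : ℕ
  k = suc k′
  last = suc (double (double k))

  -- The value `double (suc k)` makes the total length in `high-end` equal to the modulus. Its being
  -- even puts every ascent exactly one column above its descent.
  column : ℕ → ℕ
  column 0 = double (suc k)
  column 1 = last
  column (suc (suc u)) = skip (double (suc k)) u

  gap≤ : double (suc k) ≤ double (double k)
  gap≤ = double-mono-≤ (s≤s (s≤s (n≤double k′)))

  column-skip≤ : ∀ {u} → 2 + u ≤ last → column (2 + u) ≤ double (double k)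
  column-skip≤ {u} (s≤s h) = ≤-trans (skip-≤ (double (suc k)) u) h

  column-≤ : ∀ {t} → t ≤ last → column t ≤ last
  column-≤ {0} _ = m≤n⇒m≤1+n gap≤
  column-≤ {1} _ = ≤-refl
  column-≤ {suc (suc u)} h = m≤n⇒m≤1+n (column-skip≤ h)

  column-injective : ∀ {s t} → s ≤ last → t ≤ last → column s ≡ column t → s ≡ t
  column-injective {0} {0} _ _ _ = refl
  column-injective {0} {1} _ _ e = ⊥-elim (<-irrefl e (s≤s gap≤))
  column-injective {0} {suc (suc u)} _ _ e = ⊥-elim (skip-≢ (double (suc k)) u (sym e))
  column-injective {1} {0} _ _ e = ⊥-elim (<-irrefl (sym e) (s≤s gap≤))
  column-injective {1} {1} _ _ _ = refl
  column-injective {1} {suc (suc u)} _ h e = ⊥-elim (<-irrefl (sym e) (s≤s (column-skip≤ h)))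
  column-injective {suc (suc u)} {0} _ _ e = ⊥-elim (skip-≢ (double (suc k)) u e)
  column-injective {suc (suc u)} {1} h _ e = ⊥-elim (<-irrefl e (s≤s (column-skip≤ h)))
  column-injective {suc (suc u)} {suc (suc v)} _ _ e =
    cong (2 +_) (skip-injective (double (suc k)) e)

  column-surjective : ∀ {c} → c ≤ last → Σ ℕ λ t → t ≤ last × column t ≡ c
  column-surjective {c} c≤ with c ≟ double (suc k) | m≤n⇒m<n∨m≡n c≤
  ... | yes c≡ | _ = 0 , z≤n , sym c≡
  ... | no _ | inj₂ c≡ = 1 , s≤s z≤n , sym c≡
  ... | no c≢ | inj₁ (s≤s c≤′) =
    let u , u< , e = skip-surjective (double (suc k)) c≤′ gap≤ c≢ in 2 + u , s≤s u< , e

-- The zigzag base block.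

module Block (k′ N′ α i : ℕ) where

  open Columns k′ public
  open Reflection N′ public

  N L : ℕ
  N = suc N′
  L = suc last * N

  slot : ℕ → ℕ
  slot x = (i + α * x) % N

  slot-≤ : ∀ x → slot x ≤ N′
  slot-≤ x = <⇒≤pred (m%n<n (i + α * x) N)

  digit : ℕ → ℕ
  digit t = reflect (reversed t) (slot (label t))

  digit-≤ : ∀ t → digit t ≤ N′
  digit-≤ t = reflect-≤ (reversed t) (slot-≤ (label t))

  -- Both positions use the same slot, and it is reflected at exactly one of them.
  digit-twin : ∀ s t → label s ≡ label t → reversed s ≡ not (reversed t) → digit s + digit t ≡ N′
  digit-twin s t l r = trans (cong₂ (λ x b → reflect b (slot x) + digit t) l r)
    (reflect-+-not (reversed t) (slot-≤ (label t)))

  codigit-twin : ∀ s t → digit s + digit t ≡ N′ → N′ ∸ digit s ≡ digit t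
  codigit-twin s t e = trans (cong (_∸ digit s) (sym e)) (m+n∸m≡n (digit s) (digit t))

  diff : ℕ → ℕ
  diff t = suc (digit t + column t * N)

  diff-≤ : ∀ t → diff t ≤ suc (column t) * N
  diff-≤ t = +-monoˡ-≤ (column t * N) (s≤s (digit-≤ t))

  diff-> : ∀ t → column t * N < diff t
  diff-> t = s≤s (m≤n+m (column t * N) (digit t))

  diff-mono : ∀ {s t} → column s < column t → diff s < diff t
  diff-mono {s} {t} c< = ≤-<-trans (diff-≤ s) (≤-<-trans (*-monoˡ-≤ N c<) (diff-> t))

  diff-bounded : ∀ {t} → t ≤ last → diff t ≤ L
  diff-bounded {t} t≤ = ≤-trans (diff-≤ t) (*-monoˡ-≤ N (s≤s (column-≤ t≤)))

  ascent descent : ℕ → ℕ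
  descent p = double (suc p)
  ascent p = suc (double (suc p))

  -- The vertex at position `double (suc p)`. The increment is `diff (ascent p) - diff (descent p)`,
  -- written without negative numbers by using that the two columns are one apart.
  high : ℕ → ℕ
  high zero = diff 0 + diff 1
  high (suc p) = high p + suc (digit (ascent p)) + (N′ ∸ digit (descent p))

  -- The subtraction is not truncated for p < 2k, by deep-descent.
  deep : ℕ → ℕ
  deep p = high p ∸ diff (descent p)

  high-< : ∀ p → high p < high (suc p)
  high-< p = ≤-trans (≤-trans (≤-reflexive (+-comm 1 (high p)))
    (+-monoʳ-≤ (high p) (s≤s z≤n))) (m≤m+n _ _)

  high-mono-≤ : ∀ p → high 0 ≤ high p
  high-mono-≤ zero = ≤-refl
  high-mono-≤ (suc p) = ≤-trans (high-mono-≤ p) (<⇒≤ (high-< p))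

  descent-≤ : ∀ {p} → p < double k → descent p ≤ last
  descent-≤ p< = m≤n⇒m≤1+n (double-mono-≤ p<)

  ascent-≤ : ∀ {p} → p < double k → ascent p ≤ last
  ascent-≤ p< = s≤s (double-mono-≤ p<)

  -- `diff 1` lies in the last column and so exceeds every descent, while `high p` is at least
  -- `diff 1`.
  deep-descent : ∀ {p} → p < double k → deep p + diff (descent p) ≡ high p
  deep-descent {p} p< = m∸n+n≡m (≤-trans (<⇒≤ (diff-mono {descent p} {1}
    (s≤s (column-skip≤ (descent-≤ p<))))) (≤-trans (m≤n+m (diff 1) (diff 0)) (high-mono-≤ p)))

  column-ascent : ∀ p → column (ascent p) ≡ suc (column (descent p))
  column-ascent p = skip-consecutive (suc k) p

  deep-ascent : ∀ {p} → p < double k → deep p + diff (ascent p) ≡ high (suc p)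
  deep-ascent {p} p< = begin
    deep p + suc (a + column (ascent p) * N)     ≡⟨ cong (λ c → deep p + suc (a + c * N)) (column-ascent p) ⟩
    deep p + suc (a + (N + c * N))               ≡⟨ cong (λ u → deep p + suc (a + (suc u + c * N))) (sym (m+[n∸m]≡n (digit-≤ (descent p)))) ⟩
    deep p + suc (a + (suc (d + (N′ ∸ d)) + c * N)) ≡⟨ identity (deep p) a d (N′ ∸ d) (c * N) ⟩
    deep p + diff (descent p) + suc a + (N′ ∸ d) ≡⟨ cong (λ u → u + suc a + (N′ ∸ d)) (deep-descent p<) ⟩
    high p + suc a + (N′ ∸ d) ∎
    where
    open ≡-Reasoning
    a = digit (ascent p)
    d = digit (descent p)
    c = column (descent p)
    identity : ∀ x a d w q → x + suc (a + (suc (d + w) + q)) ≡ x + suc (d + q) + suc a + w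
    identity = solve-∀

  -- The two descents are twins and so are the two ascents, hence all slots cancel from the rise.
  high-quad : ∀ q → high (4 + double q) ≡ high (2 + double q) + (N + N)
  high-quad q = begin
    h + suc a₀ + (N′ ∸ d₀) + suc a₁ + (N′ ∸ d₁)
      ≡⟨ cong₂ (λ u v → h + suc a₀ + u + suc a₁ + v)
           (codigit-twin (descent (2 + double q)) (descent (3 + double q)) d-twin)
           (codigit-twin (descent (3 + double q)) (descent (2 + double q)) (trans (+-comm d₁ d₀) d-twin)) ⟩
    h + suc a₀ + d₁ + suc a₁ + d₀
      ≡⟨ identity h a₀ a₁ d₀ d₁ ⟩
    h + (suc (a₀ + a₁) + suc (d₀ + d₁))
      ≡⟨ cong₂ (λ u v → h + (suc u + suc v)) a-twin d-twin ⟩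
    h + (N + N) ∎
    where
    open ≡-Reasoning
    h = high (2 + double q)
    a₀ = digit (ascent (2 + double q))
    d₀ = digit (descent (2 + double q))
    a₁ = digit (ascent (3 + double q))
    d₁ = digit (descent (3 + double q))
    d-twin : d₀ + d₁ ≡ N′
    d-twin = digit-twin (descent (2 + double q)) (descent (3 + double q))
      (cong (3 +_) (quad-label₀ q)) (quad-reversed₀ q)
    a-twin : a₀ + a₁ ≡ N′
    a-twin = digit-twin (ascent (2 + double q)) (ascent (3 + double q))
      (cong (3 +_) (quad-label₁ q)) (quad-reversed₁ q)
    identity : ∀ h a₀ a₁ d₀ d₁ → h + suc a₀ + d₁ + suc a₁ + d₀ ≡ h + (suc (a₀ + a₁) + suc (d₀ + d₁))
    identity = solve-∀

  -- Positions 0 to 5 form the twin pairs (0, 3), (1, 5), (2, 4), each contributing `N`. The two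
  -- jumps add their columns, and the 1 left over is the one in `suc (L + L)`.
  high-2 : high 2 ≡ suc (N + N + N + (column 0 + column 1) * N)
  high-2 = begin
    diff 0 + diff 1 + suc (digit 3) + (N′ ∸ digit 2) + suc (digit 5) + (N′ ∸ digit 4)
      ≡⟨ cong₂ (λ u v → diff 0 + diff 1 + suc (digit 3) + u + suc (digit 5) + v)
           (codigit-twin 2 4 t₂₄) (codigit-twin 4 2 (trans (+-comm (digit 4) (digit 2)) t₂₄)) ⟩
    diff 0 + diff 1 + suc (digit 3) + digit 4 + suc (digit 5) + digit 2
      ≡⟨ identity (digit 0) (digit 1) (digit 2) (digit 3) (digit 4) (digit 5) (column 0) (column 1) N ⟩
    suc (suc (digit 0 + digit 3) + suc (digit 1 + digit 5) + suc (digit 2 + digit 4) + (column 0 + column 1) * N)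
      ≡⟨ cong₂ (λ u v → suc (suc u + suc v + suc (digit 2 + digit 4) + (column 0 + column 1) * N))
           (digit-twin 0 3 refl refl) (digit-twin 1 5 refl refl) ⟩
    suc (N + N + suc (digit 2 + digit 4) + (column 0 + column 1) * N)
      ≡⟨ cong (λ u → suc (N + N + suc u + (column 0 + column 1) * N)) t₂₄ ⟩
    suc (N + N + N + (column 0 + column 1) * N) ∎
    where
    open ≡-Reasoning
    t₂₄ = digit-twin 2 4 refl refl
    identity : ∀ z₀ z₁ z₂ z₃ z₄ z₅ c₀ c₁ n →
      suc (z₀ + c₀ * n) + suc (z₁ + c₁ * n) + suc z₃ + z₄ + suc z₅ + z₂ ≡
      suc (suc (z₀ + z₃) + suc (z₁ + z₅) + suc (z₂ + z₄) + (c₀ + c₁) * n)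
    identity = solve-∀

  high-even : ∀ q → high (2 + double q) ≡ high 2 + q * (N + N)
  high-even zero = sym (+-identityʳ (high 2))
  high-even (suc q) = trans (high-quad q) (trans (cong (_+ (N + N)) (high-even q))
    (identity (high 2) (q * (N + N)) (N + N)))
    where
    identity : ∀ a b c → a + b + c ≡ a + (c + b)
    identity = solve-∀

  -- The multiples of `N` add up to `3 + (2k + 2) + (4k + 1) + 2(k - 1) = 8k + 4`, twice the cycle
  -- length. So the walk from 0 ends at the modulus.
  high-end : high (double k) ≡ suc (L + L)
  high-end = begin
    high (2 + double k′)              ≡⟨ high-even k′ ⟩
    high 2 + k′ * (N + N)             ≡⟨ cong (_+ k′ * (N + N)) high-2 ⟩
    suc (N + N + N + (double (suc k) + suc (double (double k))) * N) + k′ * (N + N)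
      ≡⟨ cong₂ (λ u v → suc (N + N + N + (u + suc v) * N) + k′ * (N + N)) (double≡+ (suc k)) quadruple ⟩
    suc (N + N + N + ((suc k + suc k) + suc (k + k + (k + k))) * N) + k′ * (N + N)
      ≡⟨ identity k′ N ⟩
    suc ((2 + (k + k + (k + k))) * N + (2 + (k + k + (k + k))) * N)
      ≡⟨ cong (λ u → suc ((2 + u) * N + (2 + u) * N)) (sym quadruple) ⟩
    suc (L + L) ∎
    where
    open ≡-Reasoning
    quadruple : double (double k) ≡ k + k + (k + k)
    quadruple = trans (double≡+ (double k)) (cong₂ _+_ (double≡+ k) (double≡+ k))
    identity : ∀ k′ n →
      suc (n + n + n + ((suc (suc k′) + suc (suc k′)) + suc (suc k′ + suc k′ + (suc k′ + suc k′))) * n) + k′ * (n + n) ≡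
      suc ((2 + (suc k′ + suc k′ + (suc k′ + suc k′))) * n + (2 + (suc k′ + suc k′ + (suc k′ + suc k′))) * n)
    identity = solve-∀

  evenVertex oddVertex evenLow : ℕ → ℕ
  evenVertex zero = 0
  evenVertex (suc p) = high p
  oddVertex zero = diff 0
  oddVertex (suc p) = deep p
  evenLow zero = 0
  evenLow (suc p) = deep p

  vertex low : ℕ → ℕ
  vertex = alternate evenVertex oddVertex
  low = alternate evenLow oddVertex

  vertex-even : ∀ j → vertex (double j) ≡ evenVertex j
  vertex-even = alternate-even evenVertex oddVertex

  vertex-odd : ∀ j → vertex (suc (double j)) ≡ oddVertex j
  vertex-odd = alternate-odd evenVertex oddVertex

  low-descent : ∀ p → low (descent p) ≡ deep p
  low-descent p = alternate-even evenLow oddVertex (suc p)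

  low-ascent : ∀ p → low (ascent p) ≡ deep p
  low-ascent p = alternate-odd evenLow oddVertex (suc p)

  step : ∀ {t} → t ≤ last →
    (vertex t ≡ low t × vertex (suc t) ≡ low t + diff t) ⊎
    (vertex (suc t) ≡ low t × vertex t ≡ low t + diff t)
  step {t} t≤ with parity t
  ... | even zero = inj₁ (refl , refl)
  ... | odd zero = inj₁ (refl , refl)
  ... | even (suc p) = inj₂ (trans (vertex-odd (suc p)) (sym (low-descent p)) ,
      trans (vertex-even (suc p)) (trans (sym (deep-descent (double-≤⁻ t≤)))
        (cong (_+ diff (descent p)) (sym (low-descent p)))))
  ... | odd (suc p) = inj₁ (trans (vertex-odd (suc p)) (sym (low-ascent p)) ,
      trans (vertex-even (suc (suc p))) (trans (sym (deep-ascent (double-≤⁻ (m≤n⇒m≤1+n (≤-pred t≤)))))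
        (cong (_+ diff (ascent p)) (sym (low-ascent p)))))

  -- The next descent lies in a later column than the ascent before it, so it is longer.
  deep-> : ∀ {p} → suc p < double k → deep (suc p) < deep p
  deep-> {p} p< = +-balance-<
    (trans (deep-ascent (<-trans (n<1+n p) p<)) (sym (deep-descent p<)))
    (diff-mono {ascent p} {descent (suc p)} (skip-< (double (suc k)) (suc (double p))))

  deep-anti : ∀ {p q} → p < q → q < double k → deep q < deep p
  deep-anti {p} {suc q} p<1+q q< with m<1+n⇒m<n∨m≡n p<1+q
  ... | inj₁ p<q = <-trans (deep-> q<) (deep-anti p<q (<-trans (n<1+n q) q<))
  ... | inj₂ refl = deep-> q<

  deep-anti-≤ : ∀ {p q} → p ≤ q → q < double k → deep q ≤ deep p
  deep-anti-≤ p≤q q< with m≤n⇒m<n∨m≡n p≤q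
  ... | inj₁ p<q = <⇒≤ (deep-anti p<q q<)
  ... | inj₂ refl = ≤-refl

  deep-<high : ∀ {p} → p < double k → deep p < high 0
  deep-<high p< = ≤-<-trans (deep-anti-≤ z≤n p<)
    (subst (deep 0 <_) (deep-descent z<s) (m<m+n (deep 0) z<s))

  -- The lowest `deep` vertex starts the final ascent, which ends at `suc (L + L)` and has length at
  -- most `L`. So it lies above `L`, and `diff 0` does not.
  first-<deep : ∀ {p} → p < double k → diff 0 < deep p
  first-<deep {p} p< = ≤-<-trans (diff-bounded {0} z≤n) (≤-trans
    (+-cancelʳ-≤ L (suc L) (deep final) (≤-trans
      (≤-reflexive (trans (sym high-end) (sym (deep-ascent final<))))
      (+-monoʳ-≤ (deep final) (diff-bounded (ascent-≤ final<)))))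
    (deep-anti-≤ (≤-pred p<) final<))
    where
    final : ℕ
    final = suc (double k′)
    final< : final < double k
    final< = ≤-refl

  evenVertex-mono : ∀ {a b} → a < b → evenVertex a < evenVertex b
  evenVertex-mono = <-step⇒mono evenVertex λ { zero → z<s ; (suc p) → high-< p }

  oddVertex-injective : ∀ {a b} → a ≤ double k → b ≤ double k → oddVertex a ≡ oddVertex b → a ≡ b
  oddVertex-injective {zero} {zero} _ _ _ = refl
  oddVertex-injective {zero} {suc q} _ q< e = ⊥-elim (<-irrefl e (first-<deep q<))
  oddVertex-injective {suc p} {zero} p< _ e = ⊥-elim (<-irrefl (sym e) (first-<deep p<))
  oddVertex-injective {suc p} {suc q} p< q< e with <-cmp p q
  ... | tri< p<q _ _ = ⊥-elim (<-irrefl (sym e) (deep-anti p<q q<))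
  ... | tri≈ _ refl _ = refl
  ... | tri> _ _ q<p = ⊥-elim (<-irrefl e (deep-anti q<p p<))

  oddVertex-<high : ∀ {a} → a ≤ double k → oddVertex a < high 0
  oddVertex-<high {zero} _ = m<m+n (diff 0) z<s
  oddVertex-<high {suc p} p< = deep-<high p<

  oddVertex-positive : ∀ {a} → a ≤ double k → 0 < oddVertex a
  oddVertex-positive {zero} _ = z<s
  oddVertex-positive {suc p} p< = ≤-<-trans z≤n (first-<deep p<)

  -- The vertices at odd positions lie strictly between 0 and `high 0`, those at even positions do
  -- not.
  evenVertex≢oddVertex : ∀ {a b} → b ≤ double k → evenVertex a ≢ oddVertex b
  evenVertex≢oddVertex {zero} b≤ e = <-irrefl e (oddVertex-positive b≤)
  evenVertex≢oddVertex {suc p} b≤ e = <-irrefl (sym e) (<-≤-trans (oddVertex-<high b≤) (high-mono-≤ p))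

  vertex-≡ : ∀ {s t} → s ≤ last → t ≤ last → vertex s ≡ vertex t → s ≡ t
  vertex-≡ {s} {t} s≤ t≤ e with parity s | parity t
  ... | even a | even b = cong double (mono⇒injective evenVertex evenVertex-mono
          (trans (sym (vertex-even a)) (trans e (vertex-even b))))
  ... | odd a | odd b = cong (suc ∘ double) (oddVertex-injective
          (double-≤⁻ (m≤n⇒m≤1+n (≤-pred s≤))) (double-≤⁻ (m≤n⇒m≤1+n (≤-pred t≤)))
          (trans (sym (vertex-odd a)) (trans e (vertex-odd b))))
  ... | even a | odd b = ⊥-elim (evenVertex≢oddVertex {a} (double-≤⁻ (m≤n⇒m≤1+n (≤-pred t≤)))
          (trans (sym (vertex-even a)) (trans e (vertex-odd b))))
  ... | odd a | even b = ⊥-elim (evenVertex≢oddVertex {b} (double-≤⁻ (m≤n⇒m≤1+n (≤-pred s≤)))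
          (trans (sym (vertex-even b)) (trans (sym e) (vertex-odd a))))

  vertex-<n : ∀ {t} → t ≤ last → vertex t < suc (L + L)
  vertex-<n {t} t≤ with parity t
  ... | even a = subst₂ _<_ (sym (vertex-even a)) high-end
          (evenVertex-mono (s≤s (double-≤⁻ {a} t≤)))
  ... | odd a = subst₂ _<_ (sym (vertex-odd a)) high-end
          (<-≤-trans (oddVertex-<high (double-≤⁻ {a} (m≤n⇒m≤1+n (≤-pred t≤)))) (high-mono-≤ (double k)))

  vertex-last : vertex (suc last) ≡ suc (L + L)
  vertex-last = trans (vertex-even (suc (double k))) high-end

-- Comparison of two blocks.

digits-injective : ∀ N′ {z z′} c c′ → z ≤ N′ → z′ ≤ N′ →
  z + c * suc N′ ≡ z′ + c′ * suc N′ → z ≡ z′ × c ≡ c′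
digits-injective N′ {z} {z′} c c′ z≤ z′≤ e = z≡z′ ,
  *-cancelʳ-≡ c c′ (suc N′) (+-cancelˡ-≡ z _ _ (trans e (cong (_+ c′ * suc N′) (sym z≡z′))))
  where
  open Residue N′
  z≡z′ : z ≡ z′
  z≡z′ = ≈⇒≡ (s≤s z≤) (s≤s z′≤)
    (≈-trans (≈-sym (+-multiple≈ z c)) (≈-trans (≈-reflexive e) (+-multiple≈ z′ c′)))

module BlockPair (k′ N′ α β i j : ℕ) where

  module B = Block k′ N′ α i
  module B′ = Block k′ N′ β j
  open B using (N; L; last; column; ascent; descent; k)

  diff-≡⇒ : ∀ {s t} → B.diff s ≡ B′.diff t → B.digit s ≡ B′.digit t × column s ≡ column t
  diff-≡⇒ {s} {t} e = digits-injective N′ (column s) (column t) (B.digit-≤ s) (B′.digit-≤ t) (suc-injective e)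

  slot-≡ : ∀ t → B.diff t ≡ B′.diff t → B.slot (label t) ≡ B′.slot (label t)
  slot-≡ t e = B.reflect-injective (reversed t) (B.slot-≤ (label t)) (B′.slot-≤ (label t))
    (proj₁ (diff-≡⇒ {t} {t} e))

  module Distinct (α≢β : α ≢ β) (small : (α + β) * suc last < N) where

    -- Modulo `N` the indices `i` and `j` cancel and leave `α * x + β * y` congruent to
    -- `β * x + α * y`. Both are below `N` by `small`, so they are equal and `crossed-products`
    -- applies.
    slots-cross : ∀ {x y} → x ≤ suc last → y ≤ suc last →
      B.slot x + B′.slot y ≡ B′.slot x + B.slot y → x ≡ y
    slots-cross {x} {y} x≤ y≤ e =
      [ ⊥-elim ∘ α≢β , (λ x≡y → x≡y) ] (crossed-products α β x y
        (≈⇒≡ (bound x≤ y≤) (subst (_< N) (+-comm (α * y) (β * x)) (bound y≤ x≤))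
          (+-cancelˡ≈ (i + j) (≈-trans (≈-reflexive (id₁ i j (α * x) (β * y)))
            (≈-trans (≈-sym (+-cong≈ (%≈ (i + α * x)) (%≈ (j + β * y))))
              (≈-trans (≈-reflexive e)
                (≈-trans (+-cong≈ (%≈ (j + β * x)) (%≈ (i + α * y)))
                  (≈-reflexive (id₂ i j (β * x) (α * y))))))))))
      where
      open Residue N′
      bound : ∀ {x y} → x ≤ suc last → y ≤ suc last → α * x + β * y < N
      bound x≤ y≤ = ≤-<-trans (≤-trans (+-mono-≤ (*-monoʳ-≤ α x≤) (*-monoʳ-≤ β y≤))
        (≤-reflexive (sym (*-distribʳ-+ (suc last) α β)))) small
      id₁ : ∀ i j a b → i + j + (a + b) ≡ i + a + (j + b)
      id₁ = solve-∀
      id₂ : ∀ i j b a → j + b + (i + a) ≡ i + j + (b + a)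
      id₂ = solve-∀

    label-bound : ∀ {t} → t ≤ last → label t ≤ suc last
    label-bound {t} t≤ = ≤-trans (label-≤ t) (s≤s t≤)

    label-≡ : ∀ {s t} → s ≤ last → t ≤ last →
      B.diff s ≡ B′.diff s → B.diff t ≡ B′.diff t → label s ≡ label t
    label-≡ {s} {t} s≤ t≤ ds dt = slots-cross (label-bound s≤) (label-bound t≤)
      (cong₂ _+_ (slot-≡ s ds) (sym (slot-≡ t dt)))

    module Translates (g g′ : ℕ) where

      open Residue (L + L)

      Shared : ℕ → Set
      Shared t = B.diff t ≡ B′.diff t × B.low t + g ≈ B′.low t + g′

      sum-<n : ∀ {a b} → a ≤ L → b ≤ L → a + b < suc (L + L)
      sum-<n a≤ b≤ = s≤s (+-mono-≤ a≤ b≤)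

      diff-≈⇒≡ : ∀ {t} → t ≤ last → B.diff t ≈ B′.diff t → B.diff t ≡ B′.diff t
      diff-≈⇒≡ t≤ = ≈⇒≡ (diff-<n {last} {N} (B.diff-bounded t≤)) (diff-<n {last} {N} (B′.diff-bounded t≤))

      -- One ascent and one descent lead from `deep q` to `deep (suc q)`, and the two coincidences
      -- make this displacement common to both blocks.
      deep-offset : ∀ q → suc q < double k →
        B.deep q + g ≈ B′.deep q + g′ → B.deep (suc q) + g ≈ B′.deep (suc q) + g′ →
        B.diff (ascent q) + B′.diff (descent (suc q)) ≈ B′.diff (ascent q) + B.diff (descent (suc q))
      deep-offset q q< h h′ = offsets-cancel (B.deep q) (B′.deep q) (B.deep (suc q)) (B′.deep (suc q))
        (B.diff (ascent q)) (B′.diff (ascent q)) (B.diff (descent (suc q))) (B′.diff (descent (suc q))) h h′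
        (trans (B.deep-ascent (<-trans (n<1+n q) q<)) (sym (B.deep-descent q<)))
        (trans (B′.deep-ascent (<-trans (n<1+n q) q<)) (sym (B′.deep-descent q<)))

      twin-unshared : ∀ {s t} → Twin s t → t ≤ last → Shared s → Shared t → ⊥
      twin-unshared (twin₂ u) t≤ (ds , ls) (dt , lt) with parity u
      -- Two successive descents are shared. The displacement between them makes the ascent in
      -- between agree too, but its label has the other parity.
      ... | even q = label-parity-≢ q q
              (label-≡ {descent q} {ascent q} (B.descent-≤ q<) (B.ascent-≤ q<) ds
                (diff-≈⇒≡ (B.ascent-≤ q<) (+-cancelʳ≈ (B.diff (descent (suc q)))
                  (≈-trans (≈-reflexive (cong (B.diff (ascent q) +_) dt))
                    (deep-offset q 1+q< (deep-descent≈ q ls) (deep-descent≈ (suc q) lt))))))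
        where
        1+q< : suc q < double k
        1+q< = double-≤⁻ {2 + q} t≤
        q< = <-trans (n<1+n q) 1+q<
        deep-descent≈ : ∀ p → B.low (descent p) + g ≈ B′.low (descent p) + g′ → B.deep p + g ≈ B′.deep p + g′
        deep-descent≈ p = subst₂ (λ u v → u + g ≈ v + g′) (B.low-descent p) (B′.low-descent p)
      -- Two successive ascents are shared, so now the descent in between agrees, again against
      -- parity.
      ... | odd q = label-parity-≢ (suc q) q
              (label-≡ {descent (suc q)} {ascent q} (B.descent-≤ 1+q<) (B.ascent-≤ q<)
                (sym (diff-≈⇒≡′ (+-cancelˡ≈ (B.diff (ascent q))
                  (≈-trans (deep-offset q 1+q< (deep-ascent≈ q ls) (deep-ascent≈ (suc q) lt))
                    (≈-reflexive (cong (_+ B.diff (descent (suc q))) (sym ds))))))) ds)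
        where
        1+q< : suc q < double k
        1+q< = double-≤⁻ {2 + q} (m≤n⇒m≤1+n (≤-pred t≤))
        q< = <-trans (n<1+n q) 1+q<
        diff-≈⇒≡′ : B′.diff (descent (suc q)) ≈ B.diff (descent (suc q)) →
          B′.diff (descent (suc q)) ≡ B.diff (descent (suc q))
        diff-≈⇒≡′ h = sym (diff-≈⇒≡ (B.descent-≤ 1+q<) (≈-sym h))
        deep-ascent≈ : ∀ p → B.low (ascent p) + g ≈ B′.low (ascent p) + g′ → B.deep p + g ≈ B′.deep p + g′
        deep-ascent≈ p = subst₂ (λ u v → u + g ≈ v + g′) (B.low-ascent p) (B′.low-ascent p)
      -- The lower ends are 0 and `deep 0`, which is `diff 0 + diff 1 - diff 2`. Since `diff 0`
      -- agrees, so does `diff 1 - diff 2`; both these positions are reversed, and `slots-cross`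
      -- would equate their labels 2 and 1.
      twin-unshared twin₀ t≤ (ds , ls) (dt , lt) =
        case slots-cross (label-bound {1} 1≤) (label-bound {2} 2≤) crossed of λ ()
        where
        1≤ : 1 ≤ last
        1≤ = s≤s z≤n
        2≤ : 2 ≤ last
        2≤ = s≤s (s≤s z≤n)
        offset : B.diff 0 + B.diff 1 + B′.diff 2 ≈ B′.diff 0 + B′.diff 1 + B.diff 2
        offset = offsets-cancel 0 0 (B.deep 0) (B′.deep 0)
          (B.diff 0 + B.diff 1) (B′.diff 0 + B′.diff 1) (B.diff 2) (B′.diff 2) ls lt
          (sym (B.deep-descent {0} z<s)) (sym (B′.deep-descent {0} z<s))
        diffs : B.diff 1 + B′.diff 2 ≡ B′.diff 1 + B.diff 2
        diffs = ≈⇒≡ (sum-<n (B.diff-bounded 1≤) (B′.diff-bounded 2≤)) (sum-<n (B′.diff-bounded 1≤) (B.diff-bounded 2≤))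
          (+-cancelˡ≈ (B.diff 0) (≈-trans (≈-reflexive (sym (+-assoc (B.diff 0) _ _)))
            (≈-trans offset (≈-reflexive (trans (+-assoc (B′.diff 0) _ _)
              (cong (_+ (B′.diff 1 + B.diff 2)) (sym ds)))))))
        id : ∀ z w c e → suc (z + c) + suc (w + e) ≡ z + w + (2 + c + e)
        id = solve-∀
        digits : B.digit 1 + B′.digit 2 ≡ B′.digit 1 + B.digit 2
        digits = +-cancelʳ-≡ (2 + column 1 * N + column 2 * N) _ _
          (trans (sym (id (B.digit 1) (B′.digit 2) _ _)) (trans diffs (id (B′.digit 1) (B.digit 2) _ _)))
        unreflect : ∀ {a b c d} → a ≤ N′ → b ≤ N′ → c ≤ N′ → d ≤ N′ →
          (N′ ∸ a) + (N′ ∸ b) ≡ (N′ ∸ c) + (N′ ∸ d) → a + b ≡ c + d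
        unreflect {a} {b} {c} {d} a≤ b≤ c≤ d≤ e = +-cancelʳ-≡ ((N′ ∸ a) + (N′ ∸ b)) _ _
          (trans (pair a≤ b≤) (trans (sym (pair c≤ d≤)) (cong ((c + d) +_) (sym e))))
          where
          swap-middle : ∀ a b x y → a + b + (x + y) ≡ (a + x) + (b + y)
          swap-middle = solve-∀
          pair : ∀ {a b} → a ≤ N′ → b ≤ N′ → a + b + ((N′ ∸ a) + (N′ ∸ b)) ≡ N′ + N′
          pair {a} {b} a≤ b≤ = trans (swap-middle a b _ _) (cong₂ _+_ (m+[n∸m]≡n a≤) (m+[n∸m]≡n b≤))
        crossed : B.slot 2 + B′.slot 1 ≡ B′.slot 2 + B.slot 1
        crossed = unreflect (B.slot-≤ 2) (B′.slot-≤ 1) (B′.slot-≤ 2) (B.slot-≤ 1) digits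
      -- The lower ends are `diff 0` and `deep 1`, which is `diff 0 + diff 1 - diff 2 + diff 3 -
      -- diff 4`. Since `diff 2 + diff 4` is the same for every block, agreement of `diff 1` forces
      -- that of `diff 3`, but the labels of positions 1 and 3 are 2 and 0.
      twin-unshared twin₁ t≤ (ds , ls) (dt , lt) =
        case label-≡ {1} {3} (s≤s z≤n) (s≤s (s≤s (s≤s z≤n))) ds
          (diff-≈⇒≡ (s≤s (s≤s (s≤s z≤n))) (+-cancelˡ≈ (B.diff 1 + constant) diffs)) of λ ()
        where
        constant = 2 + N′ + column 2 * N + column 4 * N
        1< : 1 < double k
        1< = s≤s (s≤s z≤n)
        module _ (i α : ℕ) where
          private module C = Block k′ N′ α i
          descents : C.diff 2 + C.diff 4 ≡ constant
          descents = trans (id (C.digit 2) (C.digit 4) _ _)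
            (cong (λ u → 2 + u + column 2 * N + column 4 * N) (C.digit-twin 2 4 refl refl))
            where
            id : ∀ z w c e → suc (z + c) + suc (w + e) ≡ 2 + (z + w) + c + e
            id = solve-∀
          walk : C.diff 0 + (C.diff 1 + C.diff 3) ≡ C.deep 1 + constant
          walk = begin
            C.diff 0 + (C.diff 1 + C.diff 3)      ≡⟨ sym (+-assoc (C.diff 0) _ _) ⟩
            C.high 0 + C.diff 3                   ≡⟨ cong (_+ C.diff 3) (sym (C.deep-descent {0} z<s)) ⟩
            C.deep 0 + C.diff 2 + C.diff 3        ≡⟨ swap-last (C.deep 0) (C.diff 2) (C.diff 3) ⟩
            C.deep 0 + C.diff 3 + C.diff 2        ≡⟨ cong (_+ C.diff 2) (trans (C.deep-ascent {0} z<s) (sym (C.deep-descent {1} 1<))) ⟩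
            C.deep 1 + C.diff 4 + C.diff 2        ≡⟨ trans (+-assoc (C.deep 1) _ _) (cong (C.deep 1 +_) (+-comm (C.diff 4) _)) ⟩
            C.deep 1 + (C.diff 2 + C.diff 4)      ≡⟨ cong (C.deep 1 +_) descents ⟩
            C.deep 1 + constant ∎
            where
            open ≡-Reasoning
            swap-last : ∀ a b c → a + b + c ≡ a + c + b
            swap-last = solve-∀
        rotate : ∀ a b c → a + b + c ≡ a + c + b
        rotate = solve-∀
        diffs : B.diff 1 + constant + B.diff 3 ≈ B.diff 1 + constant + B′.diff 3
        diffs = ≈-trans (≈-reflexive (rotate (B.diff 1) constant (B.diff 3)))
          (≈-trans (offsets-cancel (B.diff 0) (B′.diff 0) (B.deep 1) (B′.deep 1)
              (B.diff 1 + B.diff 3) (B′.diff 1 + B′.diff 3) constant constant ls lt (walk i α) (walk j β))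
            (≈-reflexive (trans (rotate (B′.diff 1) (B′.diff 3) constant)
              (cong (λ d → d + constant + B′.diff 3) (sym ds)))))

      rigid : ∀ {s t} → s ≤ last → t ≤ last → Shared s → Shared t → s ≡ t
      rigid {s} {t} s≤ t≤ sh sh′ with label-fibre s t (label-≡ s≤ t≤ (proj₁ sh) (proj₁ sh′))
      ... | inj₁ s≡t = s≡t
      ... | inj₂ (inj₁ tw) = ⊥-elim (twin-unshared tw t≤ sh sh′)
      ... | inj₂ (inj₂ tw) = ⊥-elim (twin-unshared tw s≤ sh′ sh)

-- Assembly of the systems and their number.

module Systems (k′ N′ : ℕ) where

  open Columns k′

  N L : ℕ
  N = suc N′
  L = suc last * N

  starter : ℕ → Starter last N L
  starter α = record
    { vertex = B.vertex ∘ toℕ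
    ; low = B.low ∘ toℕ
    ; diff = B.diff ∘ toℕ
    ; step = λ i → B.step (toℕ i)
    ; vertex-close = λ i → ≈-trans (≈-reflexive (B.vertex-last (toℕ i))) (+-modulus≈ 0)
    ; vertex-injective = λ i s≤ t≤ e → B.vertex-≡ (toℕ i) s≤ t≤
        (≈⇒≡ (B.vertex-<n (toℕ i) s≤) (B.vertex-<n (toℕ i) t≤) e)
    ; diff-positive = λ _ _ → z<s
    ; diff-bounded = λ i → B.diff-bounded (toℕ i)
    ; diff-injective = diff-injective
    ; diff-surjective = diff-surjective
    }
    where
    module B (i : ℕ) = Block k′ N′ α i
    open Residue (L + L)
    open Reflection N′
    module M = Residue N′
    diff-injective : ∀ {i j s t} → s ≤ last → t ≤ last → B.diff (toℕ i) s ≡ B.diff (toℕ j) t → i ≡ j × s ≡ t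
    diff-injective {i} {j} {s} {t} s≤ t≤ e with BlockPair.diff-≡⇒ k′ N′ α α (toℕ i) (toℕ j) {s} {t} e
    ... | _ , c≡ with column-injective s≤ t≤ c≡
    ...   | refl = M.toℕ-≈-injective (M.+-cancelʳ≈ (α * label s)
              (M.mk≈ (BlockPair.slot-≡ k′ N′ α α (toℕ i) (toℕ j) s e))) , refl
    diff-surjective : ∀ {e} → 1 ≤ e → e ≤ L →
      Σ (Fin N) λ i → Σ ℕ λ t → t ≤ last × B.diff (toℕ i) t ≡ e
    diff-surjective {suc e} _ e≤
      -- Differences start at 1, so `suc e` has column `e / N` and digit `e % N`.
      with column-surjective {e / N} (<⇒≤pred (m<n*o⇒m/o<n {e} {suc last} {N} e≤))
    ... | t , t≤ , c≡ = i , t , t≤ ,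
            cong suc (trans (cong₂ (λ z c → z + c * N) digit≡ c≡) (sym (m≡m%n+[m/n]*n e N)))
      where
      y = reflect (reversed t) (e % N)
      e%≤ : e % N ≤ N′
      e%≤ = <⇒≤pred (m%n<n e N)
      -- The factor `N′` acts as -1 modulo `N`, so this block has slot `y` at `label t`.
      i = M.residue (y + α * label t * N′)
      identity : ∀ y a n → y + a * n + a ≡ y + a * suc n
      identity = solve-∀
      slot≡ : B.slot (toℕ i) (label t) ≡ y
      slot≡ = M.≈⇒≡ (s≤s (B.slot-≤ (toℕ i) (label t))) (s≤s (reflect-≤ (reversed t) e%≤))
        (M.≈-trans (M.%≈ (toℕ i + α * label t))
          (M.≈-trans (M.+-congʳ≈ (α * label t) (M.toℕ-residue≈ (y + α * label t * N′)))
            (M.≈-trans (M.≈-reflexive (identity y (α * label t) N′)) (M.+-multiple≈ y (α * label t)))))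
      digit≡ : B.digit (toℕ i) t ≡ e % N
      digit≡ = trans (cong (reflect (reversed t)) slot≡) (reflect-involutive (reversed t) e%≤)

  starters-orthogonal : ∀ {α β} → α ≢ β → (α + β) * suc last < N →
    Orthogonal (Development.system (starter α)) (Development.system (starter β))
  starters-orthogonal {α} {β} α≢β small = orthogonal (starter α) (starter β)
    (λ {i} {j} {s} {t} s≤ t≤ e → column-injective s≤ t≤
      (proj₂ (BlockPair.diff-≡⇒ k′ N′ α β (toℕ i) (toℕ j) {s} {t} e)))
    (λ i j g g′ s≤ t≤ ds dt ls lt →
      BlockPair.Distinct.Translates.rigid k′ N′ α β (toℕ i) (toℕ j) α≢β small g g′ s≤ t≤ (ds , ls) (dt , lt))

  systems : ∀ r → r * (suc last + suc last) ≤ N → MOCCS last (L + L) r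
  systems r r≤ = (λ a → Development.system (starter (toℕ a))) ,
    (λ a → Development.system-cyclic (starter (toℕ a))) ,
    λ a b a≢b → starters-orthogonal (a≢b ∘ toℕ-injective) (small (toℕ<n a) (toℕ<n b))
    where
    small : ∀ {α β} → α < r → β < r → (α + β) * suc last < N
    small {α} {β} α< β< = ≤-trans (*-monoˡ-< (suc last) (+-mono-<-≤ α< (<⇒≤ β<)))
      (≤-trans (≤-reflexive (identity r (suc last))) r≤)
      where
      identity : ∀ r l → (r + r) * l ≡ r * (l + l)
      identity = solve-∀

theorem18 : ∀ (k N : ℕ) → 1 ≤ k → 1 ≤ N →
    Σ ℕ λ r → (N ≤ (r + 1) * (96 * k + 30)) ×
    MOCCS (4 * k + 1) ((8 * k + 4) * N) r
theorem18 (suc k′) (suc N′) _ _ = r ,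
  ≤-trans (≤-reflexive (m≡m%n+[m/n]*n N w))
    (≤-trans (+-monoˡ-≤ (r * w) (<⇒≤ (m%n<n N w))) (≤-reflexive (cong (_* w) (+-comm 1 r)))) ,
  subst₂ (λ p m → MOCCS p m r) last≡ order≡ (systems r
    (≤-trans (*-monoʳ-≤ r width≤) (m/n*n≤m N w)))
  where
  open Systems k′ N′
  open Columns k′ using (k; last)
  w = 96 * k + 30
  -- Rounding down loses less than one system, whence the `r + 1` in the bound.
  r = N / w
  quadruple : double (double k) ≡ 4 * k
  quadruple = trans (double≡+ (double k)) (trans (cong₂ _+_ (double≡+ k) (double≡+ k)) (identity k))
    where
    identity : ∀ k → k + k + (k + k) ≡ 4 * k
    identity = solve-∀
  last≡ : last ≡ 4 * k + 1
  last≡ = trans (cong suc quadruple) (+-comm 1 (4 * k))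
  order≡ : L + L ≡ (8 * k + 4) * N
  order≡ = trans (cong (λ l → suc l * N + suc l * N) last≡) (identity k N)
    where
    identity : ∀ k n → suc (4 * k + 1) * n + suc (4 * k + 1) * n ≡ (8 * k + 4) * n
    identity = solve-∀
  -- Twice the cycle length is `8 * k + 4`, at most `96 * k + 30`, so `r` meets the bound that
  -- `systems` asks for.
  width≤ : suc last + suc last ≤ w
  width≤ = ≤-trans (≤-reflexive (trans (cong (λ l → suc l + suc l) last≡) (identity k)))
    (+-mono-≤ (*-monoˡ-≤ k (m≤m+n 8 88)) (m≤m+n 4 26))
    where
    identity : ∀ k → suc (4 * k + 1) + suc (4 * k + 1) ≡ 8 * k + 4
    identity = solve-∀
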